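{- For all $m\geq 2$: $s_{1,m}(122,213)=1$, $s_{2,m}(122,213)=m+1$, and for all $n\geq 3$, \[ s_{n,m}(122,213)=m\,s_{n-1,m}(122,213)+s_{n-2,m}(122,213). \]
   Context: $[n]_m=\{1^m,\ldots,n^m\}$; a permutation of $[n]_m$ is a sequence of length $nm$ in which each element of $[n]$ appears exactly $m$ times. A sequence avoids a pattern $\pi$ if it has no subsequence order-isomorphic to $\pi$ (same relative order and same equalities among entries). $s_{n,m}(\Pi)$ is the number of permutations of $[n]_m$ avoiding all patterns in $\Pi$. -}

module Defs where

open import Data.Fin.Base as Fin using (Fin; cast)
import Data.Fin.Properties as Fin
open import Data.List.Base as List
  using (List; []; _∷_; length; lookup; filter; allFin; cartesianProductWith)
open import Data.List.Membership.Propositional using (_∈_)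
open import Data.List.Membership.Propositional.Properties
  using (∈-allFin; ∈-cartesianProductWith⁺)
open import Data.List.Relation.Binary.Sublist.Propositional
  using (_⊆_; []; _∷_; _∷ʳ_)
open import Data.List.Relation.Unary.All as All using (All; [])
open import Data.List.Relation.Unary.Any using (here)
open import Data.List.Relation.Unary.Unique.Propositional using (Unique; []; _∷_)
import Data.List.Relation.Unary.Unique.Propositional.Properties as Unique
open import Data.Nat.Base as ℕ using (ℕ; zero; suc; _*_)
import Data.Nat.Properties as ℕ
open import Data.Product.Base using (Σ-syntax; ∃-syntax; _×_; _,_; proj₁)
open import Data.Sum.Base using (inj₁; inj₂; [_,_]′)
open import Data.Vec.Base as Vec using (Vec; toList; count)
import Data.Vec.Properties as Vec
open import Function.Base using (_∘_)
open import Function.Bundles using (_⇔_; mk⇔; Equivalence)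
open import Relation.Binary.PropositionalEquality using (_≡_; refl)
open import Relation.Nullary.Decidable
  using (Dec; yes; no; map′; ¬?; _×-dec_; _⊎-dec_; _→-dec_)
open import Relation.Nullary.Negation using (¬_)
open import Relation.Unary using (Decidable)

Pattern : Set
Pattern = List ℕ

pattern-122 pattern-213 : Pattern
pattern-122 = 1 ∷ 2 ∷ 2 ∷ []
pattern-213 = 2 ∷ 1 ∷ 3 ∷ []

-- The alphabet [n] is Fin n, i.e. {0,…,n-1} with its usual order; pattern
-- containment only depends on the order of the letters.

OrderIsomorphic : ∀ {n} → List (Fin n) → Pattern → Set
OrderIsomorphic u π =
  Σ[ eq ∈ length u ≡ length π ] ∀ (i j : Fin (length u)) →
    (lookup u i Fin.< lookup u j ⇔ lookup π (cast eq i) ℕ.< lookup π (cast eq j)) ×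
    (lookup u i ≡ lookup u j ⇔ lookup π (cast eq i) ≡ lookup π (cast eq j))

-- _⊆_ is the (not necessarily contiguous) subsequence relation.
Contains : ∀ {n} → Pattern → List (Fin n) → Set
Contains π w = ∃[ u ] u ⊆ w × OrderIsomorphic u π

Avoids : ∀ {n} → Pattern → List (Fin n) → Set
Avoids π w = ¬ Contains π w

IsMultisetPermutation : (n m : ℕ) → Vec (Fin n) (n * m) → Set
IsMultisetPermutation n m w = ∀ (a : Fin n) → count (a Fin.≟_) w ≡ m

IsAvoidingPermutation : (n m : ℕ) → List Pattern → Vec (Fin n) (n * m) → Set
IsAvoidingPermutation n m Π w =
  IsMultisetPermutation n m w × All (λ π → Avoids π (toList w)) Π

infix 2 _⇔-dec_

_⇔-dec_ : {A B : Set} → Dec A → Dec B → Dec (A ⇔ B)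
a? ⇔-dec b? = map′ (λ (f , g) → mk⇔ f g)
                   (λ e → Equivalence.to e , Equivalence.from e)
                   ((a? →-dec b?) ×-dec (b? →-dec a?))

orderIsomorphic? : ∀ {n} (u : List (Fin n)) (π : Pattern) → Dec (OrderIsomorphic u π)
orderIsomorphic? u π with length u ℕ.≟ length π
... | no  ne = no (ne ∘ proj₁)
... | yes eq = map′ (eq ,_) (λ (_ , h) → h)
  (Fin.all? λ i → Fin.all? λ j →
    ((lookup u i Fin.<? lookup u j)
      ⇔-dec (lookup π (cast eq i) ℕ.<? lookup π (cast eq j)))
    ×-dec
    ((lookup u i Fin.≟ lookup u j)
      ⇔-dec (lookup π (cast eq i) ℕ.≟ lookup π (cast eq j))))

∃-⊆? : {A : Set} {P : List A → Set} → Decidable P →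
       (w : List A) → Dec (∃[ u ] u ⊆ w × P u)
∃-⊆? P? [] = map′ (λ p → [] , [] , p) (λ { (_ , [] , p) → p }) (P? [])
∃-⊆? P? (x ∷ w) = map′
  [ (λ (u , s , p) → u , x ∷ʳ s , p) , (λ (u , s , p) → x ∷ u , refl ∷ s , p) ]′
  (λ { (u , _ ∷ʳ s , p)       → inj₁ (u , s , p)
     ; (_ ∷ u , refl ∷ s , p) → inj₂ (u , s , p) })
  (∃-⊆? P? w ⊎-dec ∃-⊆? (P? ∘ (x ∷_)) w)

contains? : ∀ {n} (π : Pattern) → Decidable (Contains {n} π)
contains? π = ∃-⊆? (λ u → orderIsomorphic? u π)

isAvoidingPermutation? : ∀ n m Π → Decidable (IsAvoidingPermutation n m Π)
isAvoidingPermutation? n m Π w =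
  Fin.all? (λ a → count (a Fin.≟_) w ℕ.≟ m) ×-dec
  All.all? (λ π → ¬? (contains? π (toList w))) Π

words : (n l : ℕ) → List (Vec (Fin n) l)
words n zero    = Vec.[] ∷ []
words n (suc l) = cartesianProductWith Vec._∷_ (allFin n) (words n l)

-- `words n l` lists every word exactly once, so `s` below is a cardinality.

∈-words : ∀ {n l} (w : Vec (Fin n) l) → w ∈ words n l
∈-words Vec.[]      = here refl
∈-words (a Vec.∷ w) = ∈-cartesianProductWith⁺ Vec._∷_ (∈-allFin a) (∈-words w)

words-unique : ∀ n l → Unique (words n l)
words-unique n zero    = [] ∷ []
words-unique n (suc l) =
  Unique.cartesianProductWith⁺ Vec._∷_ Vec.∷-injective (Unique.allFin⁺ n) (words-unique n l)

s : (n m : ℕ) → List Pattern → ℕ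
s n m Π = length (filter (isAvoidingPermutation? n m Π) (words n (n * m)))

{-# OPTIONS --safe #-}

-- In an avoider on an alphabet with at least two letters, write 0 < 1 < … for
-- the letters and cut at the first 0.  By 122 every larger letter occurs at most
-- once after the cut, so (as m ≥ 2) every larger letter occurs before it; by 213
-- nothing above 1 then occurs after it.  Hence the word is u 0ʲ or
-- u 0ᵃ⁺¹ 1 0ᵇ with a + 1 + b = j, where u avoids both patterns on the letters ≥ 1.
-- Letting the multiplicity j of the least letter differ from m, the numbers
-- g n j of avoiders satisfy g (n+1) j = g n m + j · g n (m-1), and eliminating
-- g n (m-1) gives the recurrence.
module Submission where

open import Defs
open import Data.Fin.Base as Fin using (Fin; zero; suc; toℕ)
import Data.Fin.Properties as Fin
open import Data.List.Base
  using (List; []; _∷_; _++_; map; length; lookup; filter; replicate; allFin; cartesianProductWith)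
open import Data.List.Membership.Propositional using (_∈_; _∉_)
open import Data.List.Membership.Propositional.Properties
  using (∈-map⁺; ∈-map⁻; ∈-++⁺ˡ; ∈-++⁺ʳ; ∈-++⁻; ∈-allFin; ∈-filter⁺; ∈-filter⁻;
         ∈-cartesianProductWith⁺; ∈-cartesianProductWith⁻)
open import Data.List.Membership.Propositional.Properties.WithK using (unique∧set⇒bag)
open import Data.List.Properties
  using (length-++; length-map; length-replicate; length-tabulate; ++-identityʳ;
         ∷-injectiveˡ; ∷-injectiveʳ; filter-++)
open import Data.List.Relation.Binary.BagAndSetEquality using (∼bag⇒↭)
open import Data.List.Relation.Binary.Permutation.Propositional.Properties using (↭-length)
open import Data.List.Relation.Binary.Sublist.Propositional
  using (_⊆_; []; _∷_; _∷ʳ_; minimum; ⊆-trans; from∈; to∈)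
import Data.List.Relation.Binary.Sublist.Propositional as Sublist
open import Data.List.Relation.Binary.Sublist.Propositional.Properties as Sublist
  using (++⁺; ++⁺ˡ; ++⁺ʳ; ∷ˡ⁻)
open import Data.List.Relation.Unary.All using ([]; _∷_)
open import Data.List.Relation.Unary.Any using (here; there)
open import Data.List.Relation.Unary.Unique.Propositional using (Unique; []; _∷_)
import Data.List.Relation.Unary.Unique.Propositional.Properties as Unique
open import Data.Nat.Base as ℕ using (ℕ; zero; suc; _+_; _*_; _∸_; _≤_; _<_; z≤n; s≤s)
import Data.Nat.Properties as ℕ
open import Data.Nat.Tactic.RingSolver using (solve-∀)
open import Data.Product.Base using (∃-syntax; Σ-syntax; _×_; _,_; proj₁; proj₂)
open import Data.Sum.Base as Sum using (_⊎_; inj₁; inj₂)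
open import Data.Vec.Base as Vec using (Vec; toList)
import Data.Vec.Properties as Vec
open import Function.Base using (_∘_)
open import Function.Bundles using (_⇔_; mk⇔; Equivalence)
open import Relation.Binary.Definitions using (tri<; tri≈; tri>)
open import Relation.Binary.PropositionalEquality
open import Relation.Nullary.Decidable using (yes; no)
open import Relation.Nullary.Negation using (¬_; contradiction)

private variable
  A B : Set
  n : ℕ

-- The two patterns as forbidden triples of letters.

Π : List Pattern
Π = pattern-122 ∷ pattern-213 ∷ []

No122 No213 Avoiding : List (Fin n) → Set
No122 w = ∀ x y → x Fin.< y → ¬ (x ∷ y ∷ y ∷ [] ⊆ w)
No213 w = ∀ x y z → y Fin.< x → x Fin.< z → ¬ (x ∷ y ∷ z ∷ [] ⊆ w)
Avoiding w = No122 w × No213 w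

-- By trichotomy on the letters of `π`, a correspondence that preserves both `<` and equality also
-- reflects them. Checking a concrete pattern then needs only the implications from `π` to `u`.
orderIsomorphic : (u : List (Fin n)) (π : Pattern) (eq : length u ≡ length π) →
  (∀ i j → (lookup π (Fin.cast eq i) ℕ.< lookup π (Fin.cast eq j) → lookup u i Fin.< lookup u j) ×
           (lookup π (Fin.cast eq i) ≡ lookup π (Fin.cast eq j) → lookup u i ≡ lookup u j)) →
  OrderIsomorphic u π
orderIsomorphic u π eq mono = eq , λ i j → mk⇔ (reflects< i j) (proj₁ (mono i j)) ,
                                            mk⇔ (reflects≡ i j) (proj₂ (mono i j))
  where
  reflects< : ∀ i j → lookup u i Fin.< lookup u j →
              lookup π (Fin.cast eq i) ℕ.< lookup π (Fin.cast eq j)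
  reflects< i j lt with ℕ.<-cmp (lookup π (Fin.cast eq i)) (lookup π (Fin.cast eq j))
  ... | tri< l _ _ = l
  ... | tri≈ _ e _ = contradiction (proj₂ (mono i j) e) (Fin.<⇒≢ lt)
  ... | tri> _ _ g = contradiction (proj₁ (mono j i) g) (ℕ.<⇒≯ lt)

  reflects≡ : ∀ i j → lookup u i ≡ lookup u j →
              lookup π (Fin.cast eq i) ≡ lookup π (Fin.cast eq j)
  reflects≡ i j e with ℕ.<-cmp (lookup π (Fin.cast eq i)) (lookup π (Fin.cast eq j))
  ... | tri< l _ _ = contradiction e (Fin.<⇒≢ (proj₁ (mono i j) l))
  ... | tri≈ _ r _ = r
  ... | tri> _ _ g = contradiction (sym e) (Fin.<⇒≢ (proj₁ (mono j i) g))

pattern 0F = zero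
pattern 1F = suc zero
pattern 2F = suc (suc zero)

module _ {w : List (Fin n)} where

  avoids122⇔ : Avoids pattern-122 w ⇔ No122 w
  avoids122⇔ = mk⇔ to from
    where
    to : Avoids pattern-122 w → No122 w
    to av x y x<y sub = av (_ , sub , orderIsomorphic (x ∷ y ∷ y ∷ []) pattern-122 refl λ where
      0F 0F → (λ { (s≤s ()) }) , λ _ → refl
      0F 1F → (λ _ → x<y) , λ ()
      0F 2F → (λ _ → x<y) , λ ()
      1F 0F → (λ { (s≤s ()) }) , λ ()
      1F 1F → (λ { (s≤s (s≤s ())) }) , λ _ → refl
      1F 2F → (λ { (s≤s (s≤s ())) }) , λ _ → refl
      2F 0F → (λ { (s≤s ()) }) , λ ()
      2F 1F → (λ { (s≤s (s≤s ())) }) , λ _ → refl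
      2F 2F → (λ { (s≤s (s≤s ())) }) , λ _ → refl)

    from : No122 w → Avoids pattern-122 w
    from avoids (x ∷ y ∷ z ∷ [] , sub , refl , iso)
      with refl ← Equivalence.from (proj₂ (iso 1F 2F)) refl =
      avoids x y (Equivalence.from (proj₁ (iso 0F 1F)) (s≤s (s≤s z≤n))) sub

  avoids213⇔ : Avoids pattern-213 w ⇔ No213 w
  avoids213⇔ = mk⇔ to from
    where
    to : Avoids pattern-213 w → No213 w
    to av x y z y<x x<z sub = av (_ , sub , orderIsomorphic (x ∷ y ∷ z ∷ []) pattern-213 refl λ where
      0F 0F → (λ { (s≤s (s≤s ())) }) , λ _ → refl
      0F 1F → (λ { (s≤s ()) }) , λ ()
      0F 2F → (λ _ → x<z) , λ ()
      1F 0F → (λ _ → y<x) , λ ()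
      1F 1F → (λ { (s≤s ()) }) , λ _ → refl
      1F 2F → (λ _ → Fin.<-trans y<x x<z) , λ ()
      2F 0F → (λ { (s≤s (s≤s ())) }) , λ ()
      2F 1F → (λ { (s≤s ()) }) , λ ()
      2F 2F → (λ { (s≤s (s≤s (s≤s ()))) }) , λ _ → refl)

    from : No213 w → Avoids pattern-213 w
    from avoids (x ∷ y ∷ z ∷ [] , sub , refl , iso) =
      avoids x y z (Equivalence.from (proj₁ (iso 1F 0F)) (s≤s (s≤s z≤n)))
                   (Equivalence.from (proj₁ (iso 0F 2F)) (s≤s (s≤s (s≤s z≤n)))) sub

avoiding-⊆ : {v w : List (Fin n)} → v ⊆ w → Avoiding w → Avoiding v
avoiding-⊆ sub (no122 , no213) =
  (λ x y x<y s → no122 x y x<y (⊆-trans s sub)) ,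
  (λ x y z y<x x<z s → no213 x y z y<x x<z (⊆-trans s sub))

-- Letter counts.

occurrences : Fin n → List (Fin n) → ℕ
occurrences a w = length (filter (a Fin.≟_) w)

occurrences-++ : (a : Fin n) (v w : List (Fin n)) →
                 occurrences a (v ++ w) ≡ occurrences a v + occurrences a w
occurrences-++ a v w =
  trans (cong length (filter-++ (a Fin.≟_) v w)) (length-++ (filter (a Fin.≟_) v))

occurrences-zero-map-suc : (u : List (Fin n)) → occurrences zero (map suc u) ≡ 0
occurrences-zero-map-suc []      = refl
occurrences-zero-map-suc (x ∷ u) = occurrences-zero-map-suc u

occurrences-suc-map-suc : (a : Fin n) (u : List (Fin n)) →
                          occurrences (suc a) (map suc u) ≡ occurrences a u
occurrences-suc-map-suc a []      = refl
occurrences-suc-map-suc a (x ∷ u) with a Fin.≟ x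
... | yes _ = cong suc (occurrences-suc-map-suc a u)
... | no  _ = occurrences-suc-map-suc a u

zeros : ℕ → List (Fin (suc n))
zeros c = replicate c zero

occurrences-zero-zeros : ∀ c → occurrences {suc n} zero (zeros c) ≡ c
occurrences-zero-zeros zero    = refl
occurrences-zero-zeros (suc c) = cong suc (occurrences-zero-zeros c)

occurrences-suc-zeros : ∀ (a : Fin n) c → occurrences (suc a) (zeros c) ≡ 0
occurrences-suc-zeros a zero    = refl
occurrences-suc-zeros a (suc c) = occurrences-suc-zeros a c

replicate-⊆ : ∀ {k} {a : Fin n} w → k ≤ occurrences a w → replicate k a ⊆ w
replicate-⊆ {k = zero}  w _ = minimum w
replicate-⊆ {k = suc k} {a} (x ∷ w) le with a Fin.≟ x
... | yes a≡x = a≡x ∷ replicate-⊆ w (ℕ.s≤s⁻¹ le)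
... | no  _   = x ∷ʳ replicate-⊆ w le

occurrences-toList : ∀ {l} (a : Fin n) (v : Vec (Fin n) l) →
                     Vec.count (a Fin.≟_) v ≡ occurrences a (toList v)
occurrences-toList a Vec.[]      = refl
occurrences-toList a (x Vec.∷ v) with a Fin.≟ x
... | yes _ = cong suc (occurrences-toList a v)
... | no  _ = occurrences-toList a v

-- Subsequences of concatenations and of shifted words.

∷-⊆-++⁻ : {x : A} {xs : List A} (p : List A) {t : List A} → x ∉ p → x ∷ xs ⊆ p ++ t → x ∷ xs ⊆ t
∷-⊆-++⁻ []      x∉p s        = s
∷-⊆-++⁻ (q ∷ p) x∉p (_ ∷ʳ s) = ∷-⊆-++⁻ p (x∉p ∘ there) s
∷-⊆-++⁻ (q ∷ p) x∉p (e ∷ s)  = contradiction (here e) x∉p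

-- The last letter decides: once it is matched inside `p`, everything before it is matched inside
-- `p` too.
last-⊆-++⁻ : (xs : List A) {x : A} (p : List A) {t : List A} →
             xs ++ x ∷ [] ⊆ p ++ t → (xs ++ x ∷ [] ⊆ p) ⊎ x ∈ t
last-⊆-++⁻ xs       []      s          = inj₂ (Sublist.lookup s (∈-++⁺ʳ xs (here refl)))
last-⊆-++⁻ []       (q ∷ p) (.q ∷ʳ s)  = Sum.map₁ (q ∷ʳ_) (last-⊆-++⁻ [] p s)
last-⊆-++⁻ []       (q ∷ p) (refl ∷ s) = inj₁ (refl ∷ minimum p)
last-⊆-++⁻ (x ∷ xs) (q ∷ p) (.q ∷ʳ s)  = Sum.map₁ (q ∷ʳ_) (last-⊆-++⁻ (x ∷ xs) p s)
last-⊆-++⁻ (_ ∷ xs) (q ∷ p) (refl ∷ s) = Sum.map₁ (refl ∷_) (last-⊆-++⁻ xs p s)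

⊆-map⁻ : (f : A → B) {ys : List B} (xs : List A) → ys ⊆ map f xs →
         ∃[ zs ] ys ≡ map f zs × zs ⊆ xs
⊆-map⁻ f []       []         = [] , refl , []
⊆-map⁻ f (x ∷ xs) (_ ∷ʳ s)   with zs , eq , s′ ← ⊆-map⁻ f xs s = zs , eq , x ∷ʳ s′
⊆-map⁻ f (x ∷ xs) (refl ∷ s) with zs , eq , s′ ← ⊆-map⁻ f xs s = x ∷ zs , cong (f x ∷_) eq , refl ∷ s′

zero∉map-suc : (u : List (Fin n)) → Fin.zero ∉ map Fin.suc u
zero∉map-suc (_ ∷ u) (there z∈) = zero∉map-suc u z∈

avoiding-map-suc⁺ : {u : List (Fin n)} → Avoiding u → Avoiding (map suc u)
avoiding-map-suc⁺ {u = u} (no122 , no213) = no122′ , no213′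
  where
  no122′ : No122 (map suc u)
  no122′ x y x<y s with ⊆-map⁻ suc u s
  ... | a ∷ b ∷ _ ∷ [] , refl , s′ = no122 a b (ℕ.s≤s⁻¹ x<y) s′

  no213′ : No213 (map suc u)
  no213′ x y z y<x x<z s with ⊆-map⁻ suc u s
  ... | a ∷ b ∷ c ∷ [] , refl , s′ = no213 a b c (ℕ.s≤s⁻¹ y<x) (ℕ.s≤s⁻¹ x<z) s′

avoiding-map-suc⁻ : {u : List (Fin n)} → Avoiding (map suc u) → Avoiding u
avoiding-map-suc⁻ (no122 , no213) =
  (λ x y x<y s → no122 (suc x) (suc y) (s≤s x<y) (Sublist.map⁺ suc s)) ,
  (λ x y z y<x x<z s → no213 (suc x) (suc y) (suc z) (s≤s y<x) (s≤s x<z) (Sublist.map⁺ suc s))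

-- Admissible tails.

record IsTail (t : List (Fin (2 + n))) : Set where
  field
    no≥2 : ∀ x → suc (suc x) ∉ t
    no11 : ¬ (1F ∷ 1F ∷ [] ⊆ t)

-- In both patterns the last letter is a largest one. An occurrence either lies wholly in
-- `map suc u`, or has its last letter in `t`, where it is at most 1. Two distinct letters do not
-- fit below 1, which rules out 213. For 122 the occurrence would be 0 1 1; its 0 can only come from
-- `t`, so both 1s do as well.
avoiding-++⁺ : {u : List (Fin (suc n))} {t : List (Fin (2 + n))} →
               Avoiding u → IsTail t → Avoiding (map suc u ++ t)
avoiding-++⁺ {u = u} {t} av tail = no122 , no213
  where
  open IsTail tail
  av′ = avoiding-map-suc⁺ av

  no122 : No122 (map suc u ++ t)
  no122 x y x<y s with last-⊆-++⁻ (x ∷ y ∷ []) (map suc u) s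
  no122 x y x<y s               | inj₁ s′ = proj₁ av′ x y x<y s′
  no122 zero 1F x<y s           | inj₂ _  = no11 (∷ˡ⁻ (∷-⊆-++⁻ (map suc u) (zero∉map-suc u) s))
  no122 (suc x) 1F (s≤s ()) s   | inj₂ _
  no122 x (suc (suc y)) x<y s   | inj₂ y∈ = no≥2 y y∈

  no213 : No213 (map suc u ++ t)
  no213 x y z y<x x<z s with last-⊆-++⁻ (x ∷ y ∷ []) (map suc u) s
  no213 x y z y<x x<z s                 | inj₁ s′ = proj₂ av′ x y z y<x x<z s′
  no213 (suc x) y 1F y<x (s≤s ()) s     | inj₂ _
  no213 x y (suc (suc z)) y<x x<z s     | inj₂ z∈ = no≥2 z z∈

oneAmongZeros : ℕ → ℕ → List (Fin (2 + n))
oneAmongZeros a b = zeros a ++ 1F ∷ zeros b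

suc∉zeros : ∀ c (x : Fin n) → suc x ∉ zeros c
suc∉zeros (suc c) x (there x∈) = suc∉zeros c x x∈

isTail-zeros : ∀ c → IsTail {n} (zeros c)
isTail-zeros c = record
  { no≥2 = λ x → suc∉zeros c (suc x)
  ; no11 = λ s → suc∉zeros c 0F (to∈ s) }

isTail-oneAmongZeros : ∀ a b → IsTail {n} (oneAmongZeros a b)
isTail-oneAmongZeros a b = record { no≥2 = no≥2 a ; no11 = no11 a }
  where
  no≥2 : ∀ a x → suc (suc x) ∉ oneAmongZeros a b
  no≥2 zero    x (there x∈) = suc∉zeros b (suc x) x∈
  no≥2 (suc a) x (there x∈) = no≥2 a x x∈

  no11 : ∀ a → ¬ (1F ∷ 1F ∷ [] ⊆ oneAmongZeros a b)
  no11 zero    (_ ∷ʳ s) = suc∉zeros b 0F (to∈ s)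
  no11 zero    (_ ∷ s)  = suc∉zeros b 0F (to∈ s)
  no11 (suc a) (_ ∷ʳ s) = no11 a s

isTail⁻ : (t : List (Fin (2 + n))) → IsTail t →
          (∃[ c ] t ≡ zeros c) ⊎ (∃[ a ] ∃[ b ] t ≡ oneAmongZeros a b)
isTail⁻ []      tail = inj₁ (0 , refl)
isTail⁻ (x ∷ t) tail with isTail⁻ t record { no≥2 = λ y → IsTail.no≥2 tail y ∘ there
                                           ; no11 = IsTail.no11 tail ∘ (x ∷ʳ_) }
isTail⁻ (0F ∷ t) tail | inj₁ (c , eq)     = inj₁ (suc c , cong (0F ∷_) eq)
isTail⁻ (0F ∷ t) tail | inj₂ (a , b , eq) = inj₂ (suc a , b , cong (0F ∷_) eq)
isTail⁻ (1F ∷ t) tail | inj₁ (c , eq)     = inj₂ (0 , c , cong (1F ∷_) eq)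
isTail⁻ (1F ∷ t) tail | inj₂ (a , b , refl) =
  contradiction (refl ∷ ++⁺ˡ (zeros a) (refl ∷ minimum (zeros b))) (IsTail.no11 tail)
isTail⁻ (suc (suc y) ∷ t) tail | _ = contradiction (here refl) (IsTail.no≥2 tail y)

-- Cutting a word at its first zero.

data FirstZeroView : List (Fin (suc n)) → Set where
  none  : (u : List (Fin n)) → FirstZeroView (map suc u)
  first : (u : List (Fin n)) (t : List (Fin (suc n))) → FirstZeroView (map suc u ++ zero ∷ t)

firstZeroView : (w : List (Fin (suc n))) → FirstZeroView w
firstZeroView []         = none []
firstZeroView (zero ∷ w) = first [] w
firstZeroView (suc x ∷ w) with firstZeroView w
... | none u    = none (x ∷ u)
... | first u t = first (x ∷ u) t

-- This is the only place where 2 ≤ m matters.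
avoiding⇒isTail : (u : List (Fin (suc n))) (t : List (Fin (2 + n))) →
                  2 ≤ occurrences 1F (map suc u ++ zero ∷ t) →
                  Avoiding (map suc u ++ zero ∷ t) → IsTail t
avoiding⇒isTail u t 2≤ (no122 , no213) = record { no≥2 = no≥2 ; no11 = no11 }
  where
  no11 : ¬ (1F ∷ 1F ∷ [] ⊆ t)
  -- The zero at the cut stands before both 1s and completes 122.
  no11 s = no122 0F 1F (s≤s z≤n) (++⁺ˡ (map suc u) (refl ∷ s))

  2≤′ : 2 ≤ occurrences 0F u + occurrences 1F t
  2≤′ = subst (2 ≤_) (trans (occurrences-++ 1F (map suc u) (0F ∷ t))
                            (cong (_+ occurrences 1F t) (occurrences-suc-map-suc 0F u))) 2≤

  1≤ : 1 ≤ occurrences 0F u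
  -- Letter 0 of `u` is letter 1 of the word. If `u` had none, at least two 1s would stand in `t`.
  1≤ with occurrences 0F u | 2≤′
  ... | zero  | le = contradiction (replicate-⊆ t le) no11
  ... | suc _ | _  = s≤s z≤n

  no≥2 : ∀ x → suc (suc x) ∉ t
  -- A 1 from before the cut, the zero at the cut and the large letter from `t` form 213.
  no≥2 x x∈ = no213 1F 0F (suc (suc x)) (s≤s z≤n) (s≤s (s≤s z≤n))
    (++⁺ (Sublist.map⁺ suc (replicate-⊆ u 1≤)) (refl ∷ from∈ x∈))

-- The zero at the cut is counted in the tail, whence `suc a`: the single 1 has a zero before it.
-- Without that zero the 1 could equally be the last letter of `map suc u`, and the decomposition
-- would not be unique.
decompose : (w : List (Fin (2 + n))) → 2 ≤ occurrences 1F w → Avoiding w →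
            ∃[ u ] ((∃[ c ] w ≡ map suc u ++ zeros c) ⊎
                    (∃[ a ] ∃[ b ] w ≡ map suc u ++ oneAmongZeros (suc a) b))
decompose w 2≤ av with firstZeroView w
... | none u    = u , inj₁ (0 , sym (++-identityʳ (map suc u)))
... | first u t with isTail⁻ t (avoiding⇒isTail u t 2≤ av)
...   | inj₁ (c , refl)     = u , inj₁ (suc c , refl)
...   | inj₂ (a , b , refl) = u , inj₂ (a , b , refl)

-- Uniqueness of the decomposition.

-- Every tail is empty or starts with a zero, so it begins where the letters
-- of u end.
data ZeroHeaded : List (Fin (suc n)) → Set where
  []  : ZeroHeaded {n} []
  _∷_ : ∀ {x} → x ≡ zero → (t : List (Fin (suc n))) → ZeroHeaded (x ∷ t)

zeroHeaded-zeros : ∀ c → ZeroHeaded {n} (zeros c)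
zeroHeaded-zeros zero    = []
zeroHeaded-zeros (suc c) = refl ∷ _

map-suc-++-injective : (u v : List (Fin n)) {t r : List (Fin (suc n))} →
                       ZeroHeaded t → ZeroHeaded r →
                       map suc u ++ t ≡ map suc v ++ r → u ≡ v × t ≡ r
map-suc-++-injective []      []      _          _          eq = refl , eq
map-suc-++-injective []      (y ∷ v) (refl ∷ _) _          ()
map-suc-++-injective (x ∷ u) []      _          (refl ∷ _) ()
map-suc-++-injective (x ∷ u) (y ∷ v) ht         hr         eq
  with refl ← Fin.suc-injective (∷-injectiveˡ eq)
     | refl , t≡r ← map-suc-++-injective u v ht hr (∷-injectiveʳ eq) = refl , t≡r

oneAmongZeros-injective : ∀ a b c d → oneAmongZeros {n} a b ≡ oneAmongZeros c d → a ≡ c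
oneAmongZeros-injective zero    b zero    d eq = refl
oneAmongZeros-injective (suc a) b (suc c) d eq =
  cong suc (oneAmongZeros-injective a b c d (∷-injectiveʳ eq))

zeros≢oneAmongZeros : ∀ c a b → zeros c ≢ oneAmongZeros {n} a b
zeros≢oneAmongZeros c a b eq =
  suc∉zeros c 0F (subst (1F ∈_) (sym eq) (∈-++⁺ʳ (zeros a) (here refl)))

-- Lengths of products and of duplicate-free lists.

length-cartesianProductWith : ∀ {C : Set} (f : A → B → C) xs ys →
                              length (cartesianProductWith f xs ys) ≡ length xs * length ys
length-cartesianProductWith f []       ys = refl
length-cartesianProductWith f (x ∷ xs) ys = trans (length-++ (map (f x) ys))
  (cong₂ _+_ (length-map (f x) ys) (length-cartesianProductWith f xs ys))

unique⇒length≡ : {xs ys : List A} → Unique xs → Unique ys →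
                 (∀ {x} → x ∈ xs ⇔ x ∈ ys) → length xs ≡ length ys
unique⇒length≡ uxs uys eq = ↭-length (∼bag⇒↭ (unique∧set⇒bag uxs uys eq))

fromList′ : ∀ {l} (w : List A) → length w ≡ l → Σ[ v ∈ Vec A l ] toList v ≡ w
fromList′ w refl = Vec.fromList w , Vec.toList∘fromList w

-- Multiplicities of the letters.

module _ (p : ℕ) where

  -- p + 1 is the paper's m; the alphabet is {0,…,n}, and the least letter has
  -- its own multiplicity j.
  record Content (n j : ℕ) (w : List (Fin (suc n))) : Set where
    field
      len   : length w ≡ j + n * suc p
      least : occurrences zero w ≡ j
      other : ∀ a → occurrences (suc a) w ≡ suc p

  record TailContent (c e : ℕ) (t : List (Fin (2 + n))) : Set where
    field
      len   : length t ≡ c + e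
      zero# : occurrences 0F t ≡ c
      one#  : occurrences 1F t ≡ e
      rest# : ∀ x → occurrences (suc (suc x)) t ≡ 0

  tailContent-zeros : ∀ c → TailContent {n} c 0 (zeros c)
  tailContent-zeros c = record
    { len   = trans (length-replicate c) (sym (ℕ.+-identityʳ c))
    ; zero# = occurrences-zero-zeros c
    ; one#  = occurrences-suc-zeros 0F c
    ; rest# = λ x → occurrences-suc-zeros (suc x) c }

  tailContent-oneAmongZeros : ∀ a b → TailContent {n} (a + b) 1 (oneAmongZeros a b)
  tailContent-oneAmongZeros a b = record
    { len   = trans (length-++ (zeros a))
                (trans (cong₂ (λ k l → k + suc l) (length-replicate a) (length-replicate b))
                       (trans (ℕ.+-suc a b) (ℕ.+-comm 1 (a + b))))
    ; zero# = trans (occurrences-++ 0F (zeros a) (1F ∷ zeros b))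
                (cong₂ _+_ (occurrences-zero-zeros a) (occurrences-zero-zeros b))
    ; one#  = trans (occurrences-++ 1F (zeros a) (1F ∷ zeros b))
                (cong₂ (λ k l → k + suc l) (occurrences-suc-zeros 0F a) (occurrences-suc-zeros 0F b))
    ; rest# = λ x → trans (occurrences-++ (suc (suc x)) (zeros a) (1F ∷ zeros b))
                (cong₂ _+_ (occurrences-suc-zeros (suc x) a) (occurrences-suc-zeros (suc x) b)) }

  module _ {n c e i : ℕ} {t : List (Fin (2 + n))} (u : List (Fin (suc n)))
           (tc : TailContent c e t) (i+e≡m : i + e ≡ suc p) where
    open TailContent tc

    length-word : length (map suc u ++ t) ≡ length u + (c + e)
    length-word = trans (length-++ (map suc u)) (cong₂ _+_ (length-map suc u) len)

    least-word : occurrences 0F (map suc u ++ t) ≡ c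
    least-word = trans (occurrences-++ 0F (map suc u) t)
                       (cong₂ _+_ (occurrences-zero-map-suc u) zero#)

    one-word : occurrences 1F (map suc u ++ t) ≡ occurrences 0F u + e
    one-word = trans (occurrences-++ 1F (map suc u) t)
                     (cong₂ _+_ (occurrences-suc-map-suc 0F u) one#)

    rest-word : ∀ x → occurrences (suc (suc x)) (map suc u ++ t) ≡ occurrences (suc x) u
    rest-word x = trans (occurrences-++ (suc (suc x)) (map suc u) t)
      (trans (cong₂ _+_ (occurrences-suc-map-suc (suc x) u) (rest# x)) (ℕ.+-identityʳ _))

    rearrange : ∀ i k c e → (i + k) + (c + e) ≡ c + ((i + e) + k)
    rearrange = solve-∀

    length-total : (i + n * suc p) + (c + e) ≡ c + (suc p + n * suc p)
    length-total = trans (rearrange i (n * suc p) c e) (cong (λ k → c + (k + n * suc p)) i+e≡m)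

    -- The least letter of `u` becomes letter 1 of the word, so its `i` copies and the `e` ones of
    -- the tail must add up to `suc p`. The uses are `e = 0` with `i = suc p`, and `e = 1` with
    -- `i = p`; the latter is why the least letter needs its own multiplicity.
    content⁺ : Content n i u → Content (suc n) c (map suc u ++ t)
    content⁺ cu = record
      { len   = trans length-word (trans (cong (_+ (c + e)) (Content.len cu)) length-total)
      ; least = least-word
      ; other = λ where
          zero    → trans one-word (trans (cong (_+ e) (Content.least cu)) i+e≡m)
          (suc x) → trans (rest-word x) (Content.other cu x) }

    -- Counting zeros identifies the prescribed `j` with the number `c` found in the tail;
    -- cancelling the tail from the other counts leaves those of `u`.
    content⁻ : ∀ {j} → Content (suc n) j (map suc u ++ t) → j ≡ c × Content n i u
    content⁻ {j} cw with refl ← trans (sym (Content.least cw)) least-word = refl , record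
      { len   = ℕ.+-cancelʳ-≡ (c + e) _ _
                  (trans (sym length-word) (trans (Content.len cw) (sym length-total)))
      ; least = ℕ.+-cancelʳ-≡ e _ _ (trans (sym one-word) (trans (Content.other cw 0F) (sym i+e≡m)))
      ; other = λ x → trans (sym (rest-word x)) (Content.other cw (suc x)) }

  -- Recursive enumeration of the avoiders.

  Good : (n j : ℕ) → List (Fin (suc n)) → Set
  Good n j w = Content n j w × Avoiding w

  -- `k` selects one of the `j` places for the 1 that have at least one zero before them, hence
  -- `suc (toℕ k)`; the total number of zeros stays `j`.
  insertOne : ∀ {n} j → Fin j → List (Fin (suc n)) → List (Fin (2 + n))
  insertOne j k u = map suc u ++ oneAmongZeros (suc (toℕ k)) (j ∸ suc (toℕ k))

  appendZeros : ∀ {n} → ℕ → List (Fin (suc n)) → List (Fin (2 + n))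
  appendZeros j u = map suc u ++ zeros j

  -- The second list draws `u` from `enum n p`, because the remaining copy of its least letter is
  -- the 1 inserted among the zeros.
  enum : (n j : ℕ) → List (List (Fin (suc n)))
  enum zero    j = zeros j ∷ []
  enum (suc n) j = map (appendZeros j) (enum n (suc p)) ++
                   cartesianProductWith (insertOne j) (allFin j) (enum n p)

  length-enum : ∀ n j → length (enum (suc n) j) ≡ length (enum n (suc p)) + j * length (enum n p)
  length-enum n j = trans (length-++ (map (appendZeros j) (enum n (suc p))))
    (cong₂ _+_ (length-map (appendZeros j) (enum n (suc p)))
      (trans (length-cartesianProductWith (insertOne j) (allFin j) (enum n p))
             (cong (_* length (enum n p)) (length-tabulate {n = j} _))))

  -- The first zero marks where `u` ends, so `u` and the place of the 1 can be read off from the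
  -- word. The two lists are disjoint because only the second has a 1 after the first zero.
  enum-unique : ∀ n j → Unique (enum n j)
  enum-unique zero    j = [] ∷ []
  enum-unique (suc n) j = Unique.++⁺
    (Unique.map⁺ (proj₁ ∘ map-suc-++-injective _ _ (zeroHeaded-zeros j) (zeroHeaded-zeros j))
                 (enum-unique n (suc p)))
    (Unique.cartesianProductWith⁺ (insertOne j) insertOne-injective
                 (Unique.allFin⁺ j) (enum-unique n p))
    disjoint
    where
    insertOne-injective : ∀ {k l : Fin j} {u v} → insertOne j k u ≡ insertOne j l v → k ≡ l × u ≡ v
    insertOne-injective {k} {l} {u} {v} eq
      with refl , t≡r ← map-suc-++-injective u v (refl ∷ _) (refl ∷ _) eq =
      Fin.toℕ-injective (ℕ.suc-injective (oneAmongZeros-injective (suc (toℕ k)) _ (suc (toℕ l)) _ t≡r)) , refl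

    disjoint : ∀ {w} → ¬ (w ∈ map (appendZeros j) (enum n (suc p)) ×
                          w ∈ cartesianProductWith (insertOne j) (allFin j) (enum n p))
    disjoint (w∈ , w∈′)
      with u , _ , refl ← ∈-map⁻ (appendZeros j) w∈
         | k , v , _ , _ , eq ← ∈-cartesianProductWith⁻ (insertOne j) (allFin j) (enum n p) w∈′ =
      zeros≢oneAmongZeros j (suc (toℕ k)) (j ∸ suc (toℕ k))
        (proj₂ (map-suc-++-injective u v (zeroHeaded-zeros j) (refl ∷ _) eq))

  m+0≡m : suc p + 0 ≡ suc p
  m+0≡m = ℕ.+-identityʳ (suc p)

  p+1≡m : p + 1 ≡ suc p
  p+1≡m = ℕ.+-comm p 1

  unary : (w : List (Fin 1)) → w ≡ zeros (length w)
  unary []         = refl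
  unary (zero ∷ w) = cong (zero ∷_) (unary w)

  enum-sound : ∀ n {j w} → w ∈ enum n j → Good n j w
  enum-sound zero {j} (here refl) =
    record { len = trans (length-replicate j) (sym (ℕ.+-identityʳ j))
           ; least = occurrences-zero-zeros j
           ; other = λ () } ,
    -- A one-letter alphabet has no strictly smaller letter, so neither pattern fits.
    (λ { zero zero () _ }) , (λ { zero zero _ () _ _ })
  enum-sound (suc n) {j} w∈ with ∈-++⁻ (map (appendZeros j) (enum n (suc p))) w∈
  ... | inj₁ w∈₁
    with u , u∈ , refl ← ∈-map⁻ (appendZeros j) w∈₁
    with content , av ← enum-sound n u∈ =
    content⁺ u (tailContent-zeros j) m+0≡m content , avoiding-++⁺ av (isTail-zeros j)
  ... | inj₂ w∈₂
    with k , u , _ , u∈ , refl ← ∈-cartesianProductWith⁻ (insertOne j) (allFin j) (enum n p) w∈₂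
    with content , av ← enum-sound n u∈ =
    -- The tail has `suc (toℕ k) + (j ∸ suc (toℕ k))` zeros, which is `j` since `toℕ k < j`.
    subst (λ i → Content (suc n) i (insertOne j k u)) (ℕ.m+[n∸m]≡n (Fin.toℕ<n k))
      (content⁺ u (tailContent-oneAmongZeros (suc (toℕ k)) _) p+1≡m content) ,
    avoiding-++⁺ av (isTail-oneAmongZeros (suc (toℕ k)) _)

  -- Letter 1 occurs `suc p` times, so `0 < p` makes `decompose` applicable. The part `u` inherits
  -- avoidance as a shifted prefix, and `content⁻` supplies the multiplicities that the recursive
  -- call expects.
  enum-complete : 0 < p → ∀ n {j w} → Good n j w → w ∈ enum n j
  enum-complete 0<p zero {j} {w} (content , _) =
    here (trans (unary w) (cong zeros (trans (Content.len content) (ℕ.+-identityʳ j))))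
  enum-complete 0<p (suc n) {j} {w} (content , av)
    with decompose w (subst (2 ≤_) (sym (Content.other content 0F)) (s≤s 0<p)) av
  ... | u , inj₁ (c , refl)
    with refl , content′ ← content⁻ u (tailContent-zeros c) m+0≡m content =
    ∈-++⁺ˡ (∈-map⁺ (appendZeros c) (enum-complete 0<p n
      (content′ , avoiding-map-suc⁻ (avoiding-⊆ (++⁺ʳ (zeros c) Sublist.⊆-refl) av))))
  ... | u , inj₂ (a , b , refl)
    with refl , content′ ← content⁻ u (tailContent-oneAmongZeros (suc a) b) p+1≡m content =
    ∈-++⁺ʳ (map (appendZeros (suc a + b)) (enum n (suc p)))
      (subst (_∈ cartesianProductWith (insertOne (suc a + b)) (allFin (suc a + b)) (enum n p)) shape
        (∈-cartesianProductWith⁺ (insertOne (suc a + b)) (∈-allFin k) (enum-complete 0<p n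
          (content′ , avoiding-map-suc⁻
            (avoiding-⊆ (++⁺ʳ (oneAmongZeros (suc a) b) Sublist.⊆-refl) av)))))
    where
    k : Fin (suc a + b)
    -- `insertOne` puts `suc (toℕ k)` zeros before the 1, so the index for `suc a` zeros is `a`.
    k = Fin.fromℕ< (ℕ.m≤m+n (suc a) b)

    toℕ-k : toℕ k ≡ a
    toℕ-k = Fin.toℕ-fromℕ< (ℕ.m≤m+n (suc a) b)

    shape : insertOne (suc a + b) k u ≡ map suc u ++ oneAmongZeros (suc a) b
    shape = cong (map suc u ++_) (trans
      (cong (λ l → oneAmongZeros (suc l) (a + b ∸ l)) toℕ-k)
      (cong (oneAmongZeros (suc a)) (ℕ.m+n∸m≡n a b)))

  -- From the enumeration to `s` and its recurrence.

  good⇔ : ∀ n (v : Vec (Fin (suc n)) (suc n * suc p)) →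
          IsAvoidingPermutation (suc n) (suc p) Π v ⇔ Good n (suc p) (toList v)
  good⇔ n v = mk⇔ to from
    where
    to : IsAvoidingPermutation (suc n) (suc p) Π v → Good n (suc p) (toList v)
    to (perm , a₁ ∷ a₂ ∷ []) =
      record { len   = Vec.length-toList v
             ; least = trans (sym (occurrences-toList zero v)) (perm zero)
             ; other = λ a → trans (sym (occurrences-toList (suc a) v)) (perm (suc a)) } ,
      Equivalence.to avoids122⇔ a₁ , Equivalence.to avoids213⇔ a₂

    from : Good n (suc p) (toList v) → IsAvoidingPermutation (suc n) (suc p) Π v
    from (content , no122 , no213) =
      (λ where
        zero    → trans (occurrences-toList zero v) (Content.least content)
        (suc a) → trans (occurrences-toList (suc a) v) (Content.other content a)) ,
      Equivalence.from avoids122⇔ no122 ∷ Equivalence.from avoids213⇔ no213 ∷ []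

  -- Since `toList` is injective, the filtered words and `enum` are both duplicate-free lists;
  -- soundness and completeness give them the same members.
  s≡length-enum : 0 < p → ∀ n → s (suc n) (suc p) Π ≡ length (enum n (suc p))
  s≡length-enum 0<p n = trans (sym (length-map toList avoiders))
    (unique⇒length≡
      (Unique.map⁺ (λ {v} {w} eq → trans (sym (Vec.cast-is-id refl v)) (Vec.toList-injective refl v w eq))
        (Unique.filter⁺ avoiding? (words-unique (suc n) (suc n * suc p))))
      (enum-unique n (suc p))
      (mk⇔ to from))
    where
    avoiding? = isAvoidingPermutation? (suc n) (suc p) Π
    avoiders  = filter avoiding? (words (suc n) (suc n * suc p))

    to : ∀ {w} → w ∈ map toList avoiders → w ∈ enum n (suc p)
    to w∈ with v , v∈ , refl ← ∈-map⁻ toList w∈ =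
      enum-complete 0<p n (Equivalence.to (good⇔ n v)
        (proj₂ (∈-filter⁻ avoiding? {xs = words (suc n) (suc n * suc p)} v∈)))

    from : ∀ {w} → w ∈ enum n (suc p) → w ∈ map toList avoiders
    from {w} w∈ with good@(content , _) ← enum-sound n w∈
      -- `suc n * suc p` reduces to `suc p + n * suc p`, so `len` at `j = suc p` is exactly the
      -- required vector length.
      with v , refl ← fromList′ w (Content.len content) =
      ∈-map⁺ toList (∈-filter⁺ avoiding? (∈-words v) (Equivalence.from (good⇔ n v) good))

  recurrence : ∀ n → length (enum (2 + n) (suc p)) ≡
                     suc p * length (enum (suc n) (suc p)) + length (enum n (suc p))
  recurrence n
    rewrite length-enum (suc n) (suc p) | length-enum n (suc p) | length-enum n p =
    identity p (length (enum n (suc p))) (length (enum n p))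
    where
    -- `a` and `b` count the avoiders whose least letter has multiplicity `suc p` and `p`. On both
    -- sides `b` has coefficient `(1 + p) * (1 + p)`.
    identity : ∀ p a b → (a + (1 + p) * b) + (1 + p) * (a + p * b) ≡ (1 + p) * (a + (1 + p) * b) + a
    identity = solve-∀

theorem6 : ∀ (m : ℕ) → 2 ≤ m →
    let Π = pattern-122 ∷ pattern-213 ∷ [] in
    (s 1 m Π ≡ 1) ×
    (s 2 m Π ≡ m + 1) ×
    (∀ (n : ℕ) → 3 ≤ n → s n m Π ≡ m * s (n ∸ 1) m Π + s (n ∸ 2) m Π)
theorem6 (suc p) (s≤s 0<p) = one , two , rec
  where
  count = s≡length-enum p 0<p

  one : s 1 (suc p) Π ≡ 1
  one = count 0

  two : s 2 (suc p) Π ≡ suc p + 1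
  -- `enum 0` holds a single word for each multiplicity, which gives `1 + suc p * 1`.
  two = trans (count 1) (trans (length-enum p 0 (suc p))
    (trans (cong (1 +_) (ℕ.*-identityʳ (suc p))) (ℕ.+-comm 1 (suc p))))

  rec : ∀ n → 3 ≤ n → s n (suc p) Π ≡
                      suc p * s (n ∸ 1) (suc p) Π + s (n ∸ 2) (suc p) Π
  -- `enum n` uses `suc n` letters, so alphabet sizes `3 + n`, `2 + n` and `1 + n` correspond to
  -- indices one lower.
  rec (suc (suc (suc n))) _ = trans (count (2 + n)) (trans (recurrence p n)
    (sym (cong₂ (λ a b → suc p * a + b) (count (1 + n)) (count n))))
  rec (suc zero) (s≤s ())
  rec (suc (suc zero)) (s≤s (s≤s ()))
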